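{- Let $X$ be a compact space and let $E$ be an equivalence relation on $X$. If $E$ has an equivalence class which is not closed, then $E$ does not have any closed graphing of finite diameter.
   Context: A graphing of $E$ is a simple undirected graph $G\subseteq X\times X$ whose connectedness relation (connected by a finite path) equals $E$; it is closed if $G$ is closed in $X\times X$. $G$ has finite diameter $k$ if $k$ is the least integer such that any two $G$-connected points are joined by a path of length at most $k$. Spaces are recursive Polish spaces. -}

module Defs where

open import Level using (Level; suc; _⊔_)
open import Data.Nat.Base as ℕ using (ℕ)
open import Data.Integer.Base using (+_)
open import Data.Rational.Base using (ℚ; 0ℚ; 1ℚ; _+_; _<_; -_; _/_)
open import Data.Rational.Properties using (<-dense; <-trans; <-asym; ≤-<-trans; ≮⇒≥; _<?_)
open import Data.Fin.Base using (Fin)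
open import Data.Vec.Base using (Vec; []; _∷_; lookup)
open import Data.List.Base using (List)
open import Data.List.Relation.Unary.Any using (Any)
open import Data.Product using (Σ; ∃; ∃₂; _×_; _,_)
open import Data.Sum.Base using (_⊎_; inj₁; inj₂)
open import Function.Bundles using (_⇔_; mk⇔)
open import Relation.Binary.Bundles using (Setoid)
open import Relation.Binary.Core using (Rel; _⇒_)
open import Relation.Binary.Definitions using (Symmetric; Irreflexive; _Respects₂_)
open import Relation.Binary.Structures using (IsEquivalence)
open import Relation.Nullary using (¬_; yes; no)
open import Relation.Nullary.Decidable using (from-yes)
open import Relation.Unary using (Pred; _∈_; _⊆_; ∁; _⟨×⟩_)

private
  variable
    ℓ : Level
    n m : ℕ

-- Dedekind reals: Lower q means q < r, and Upper q means r < q.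

record ℝ : Set₁ where
  field
    Lower Upper   : ℚ → Set
    lower-inhab   : ∃ λ q → Lower q
    upper-inhab   : ∃ λ q → Upper q
    lower-rounded : ∀ q → Lower q ⇔ (∃ λ p → q < p × Lower p)
    upper-rounded : ∀ q → Upper q ⇔ (∃ λ p → p < q × Upper p)
    disjoint      : ∀ q → ¬ (Lower q × Upper q)
    located       : ∀ {p q} → p < q → Lower p ⊎ Upper q

infix 4 _≃_ _<ᵣ_ _≤ᵣ_

_<ᵣ_ : ℝ → ℚ → Set
r <ᵣ q = ℝ.Upper r q

_≤ᵣ_ : ℝ → ℚ → Set
r ≤ᵣ q = ¬ ℝ.Lower r q

_≃_ : ℝ → ℝ → Set
r ≃ s = ∀ q → (ℝ.Lower r q ⇔ ℝ.Lower s q) × (ℝ.Upper r q ⇔ ℝ.Upper s q)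

0ℝ : ℝ
0ℝ = record
  { Lower         = λ q → q < 0ℚ
  ; Upper         = λ q → 0ℚ < q
  ; lower-inhab   = - 1ℚ , from-yes (- 1ℚ <? 0ℚ)
  ; upper-inhab   = 1ℚ , from-yes (0ℚ <? 1ℚ)
  ; lower-rounded = λ q → mk⇔
      (λ q<0 → <-dense q<0)
      (λ { (_ , q<p , p<0) → <-trans q<p p<0 })
  ; upper-rounded = λ q → mk⇔
      (λ 0<q → let p , 0<p , p<q = <-dense 0<q in p , p<q , 0<p)
      (λ { (_ , p<q , 0<p) → <-trans 0<p p<q })
  ; disjoint      = λ { _ (q<0 , 0<q) → <-asym q<0 0<q }
  ; located       = located
  }
  where
  located : ∀ {p q} → p < q → p < 0ℚ ⊎ 0ℚ < q
  located {p} p<q with p <? 0ℚ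
  ... | yes p<0 = inj₁ p<0
  ... | no  p≮0 = inj₂ (≤-<-trans (≮⇒≥ p≮0) p<q)

-- μ-recursive functions, with their graphs  f [ xs ]↓ y.

data Rec : ℕ → Set where
  zer  : Rec n
  succ : Rec 1
  proj : Fin n → Rec n
  comp : Rec m → Vec (Rec n) m → Rec n
  prec : Rec n → Rec (2 ℕ.+ n) → Rec (1 ℕ.+ n)
  min  : Rec (1 ℕ.+ n) → Rec n

infix 4 _[_]↓_

data _[_]↓_ : Rec n → Vec ℕ n → ℕ → Set where
  zer↓  : ∀ {xs : Vec ℕ n} → zer [ xs ]↓ 0
  succ↓ : ∀ {x} → succ [ x ∷ [] ]↓ ℕ.suc x
  proj↓ : ∀ {xs : Vec ℕ n} i → proj i [ xs ]↓ lookup xs i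
  comp↓ : ∀ {f : Rec m} {gs : Vec (Rec n) m} {xs ys z} →
          (∀ i → lookup gs i [ xs ]↓ lookup ys i) → f [ ys ]↓ z →
          comp f gs [ xs ]↓ z
  prec↓-zero : ∀ {f : Rec n} {g xs y} →
               f [ xs ]↓ y → prec f g [ 0 ∷ xs ]↓ y
  prec↓-suc  : ∀ {f : Rec n} {g xs k y z} →
               prec f g [ k ∷ xs ]↓ y → g [ k ∷ y ∷ xs ]↓ z →
               prec f g [ ℕ.suc k ∷ xs ]↓ z
  min↓  : ∀ {f : Rec (1 ℕ.+ n)} {xs y} →
          (∀ z → z ℕ.< y → ∃ λ v → f [ z ∷ xs ]↓ ℕ.suc v) →
          f [ y ∷ xs ]↓ 0 → min f [ xs ]↓ y

RecursiveRelation : Pred (Vec ℕ n) ℓ → Set ℓ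
RecursiveRelation {n} R = Σ (Rec n) λ χ →
  ∀ xs → (R xs × χ [ xs ]↓ 1) ⊎ (¬ R xs × χ [ xs ]↓ 0)

-- Points are taken up to the setoid equality _≈_, which coincides with
-- being at distance 0.

record MetricSpace ℓ : Set (suc ℓ ⊔ suc Level.zero) where
  field
    setoid : Setoid ℓ ℓ
  open Setoid setoid public using (Carrier; _≈_)
  field
    d        : Carrier → Carrier → ℝ
    d-zero   : ∀ x y → d x y ≃ 0ℝ ⇔ x ≈ y
    d-sym    : ∀ x y → d x y ≃ d y x
    -- d x z ≤ d x y + d y z : the upper cut of a sum of two reals consists
    -- of the sums of elements of their upper cuts.
    triangle : ∀ x y z {p q} → d x y <ᵣ p → d y z <ᵣ q → d x z <ᵣ p + q

  Cauchy : (ℕ → Carrier) → Set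
  Cauchy s = ∀ {ε} → 0ℚ < ε →
    ∃ λ N → ∀ i j → N ℕ.≤ i → N ℕ.≤ j → d (s i) (s j) <ᵣ ε

  _ConvergesTo_ : (ℕ → Carrier) → Carrier → Set
  s ConvergesTo x = ∀ {ε} → 0ℚ < ε → ∃ λ N → ∀ i → N ℕ.≤ i → d (s i) x <ᵣ ε

  Complete : Set ℓ
  Complete = ∀ s → Cauchy s → ∃ λ x → s ConvergesTo x

  Dense : (ℕ → Carrier) → Set ℓ
  Dense r = ∀ x {ε} → 0ℚ < ε → ∃ λ i → d x (r i) <ᵣ ε

  -- The relations d(rᵢ, rⱼ) ≤ m/(k+1) and d(rᵢ, rⱼ) < m/(k+1) on ℕ⁴.
  Dist≤ Dist< : (ℕ → Carrier) → Pred (Vec ℕ 4) Level.zero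
  Dist≤ r (i ∷ j ∷ m ∷ k ∷ []) = d (r i) (r j) ≤ᵣ + m / ℕ.suc k
  Dist< r (i ∷ j ∷ m ∷ k ∷ []) = d (r i) (r j) <ᵣ + m / ℕ.suc k

-- A complete metric space with a recursive presentation
-- (in the sense of Moschovakis).

record RecursivePolishSpace ℓ : Set (suc ℓ ⊔ suc Level.zero) where
  field
    metricSpace : MetricSpace ℓ
  open MetricSpace metricSpace public
  field
    complete        : Complete
    r               : ℕ → Carrier
    dense           : Dense r
    recursive-dist≤ : RecursiveRelation (Dist≤ r)
    recursive-dist< : RecursiveRelation (Dist< r)

module _ (X : RecursivePolishSpace ℓ) where
  open RecursivePolishSpace X

  Open : Pred Carrier ℓ → Set ℓ
  Open U = ∀ {x} → x ∈ U → ∃ λ ε → 0ℚ < ε × (∀ {y} → d x y <ᵣ ε → y ∈ U)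

  Closed : Pred Carrier ℓ → Set ℓ
  Closed A = Open (∁ A)

  -- Product topology on X × X.
  Open² : Pred (Carrier × Carrier) ℓ → Set (suc ℓ)
  Open² W = ∀ {x y} → (x , y) ∈ W →
    ∃₂ λ U V → Open U × Open V × x ∈ U × y ∈ V × (U ⟨×⟩ V) ⊆ W

  Closed² : Pred (Carrier × Carrier) ℓ → Set (suc ℓ)
  Closed² A = Open² (∁ A)

  Compact : Set (suc ℓ)
  Compact = ∀ {I : Set ℓ} (U : I → Pred Carrier ℓ) →
    (∀ i → Open (U i)) → (∀ x → ∃ λ i → x ∈ U i) →
    Σ (List I) λ is → ∀ x → Any (λ i → x ∈ U i) is

  record IsEquivalenceRelation (E : Rel Carrier ℓ) : Set ℓ where
    field
      isEquivalence : IsEquivalence E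
      -- E is a relation on points, hence invariant under _≈_.
      ≈⇒E           : _≈_ ⇒ E

  EquivalenceClass : Rel Carrier ℓ → Carrier → Pred Carrier ℓ
  EquivalenceClass E x y = E x y

  record IsSimpleGraph (G : Rel Carrier ℓ) : Set ℓ where
    field
      respects    : G Respects₂ _≈_
      symmetric   : Symmetric G
      irreflexive : Irreflexive _≈_ G

  data Path (G : Rel Carrier ℓ) : ℕ → Rel Carrier ℓ where
    nil  : ∀ {x y} → x ≈ y → Path G 0 x y
    cons : ∀ {n x y z} → G x y → Path G n y z → Path G (ℕ.suc n) x z

  Connected : Rel Carrier ℓ → Rel Carrier ℓ
  Connected G x y = ∃ λ n → Path G n x y

  record IsGraphing (E G : Rel Carrier ℓ) : Set ℓ where
    field
      isSimpleGraph : IsSimpleGraph G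
      connectedness : ∀ x y → Connected G x y ⇔ E x y

  IsClosedGraph : Rel Carrier ℓ → Set (suc ℓ)
  IsClosedGraph G = Closed² (λ (x , y) → G x y)

  DiameterAtMost : Rel Carrier ℓ → ℕ → Set ℓ
  DiameterAtMost G k = ∀ x y → Connected G x y → ∃ λ n → n ℕ.≤ k × Path G n x y

  HasDiameter : Rel Carrier ℓ → ℕ → Set ℓ
  HasDiameter G k = DiameterAtMost G k × (∀ j → DiameterAtMost G j → k ℕ.≤ j)

  HasFiniteDiameter : Rel Carrier ℓ → Set ℓ
  HasFiniteDiameter G = ∃ λ k → HasDiameter G k

{-# OPTIONS --safe #-}
-- Fix a point x and a closed graph G.  The set of points joined to x by a path
-- of length 0 is the closed set {x}, and the points joined to x by a path of
-- length n + 1 are the first coordinates of the closed set G ∩ (X × Aₙ), where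
-- Aₙ is the set for n; by compactness of X (tube lemma) that projection is
-- closed.  If G has diameter at most k, the class of x is A₀ ∪ … ∪ Aₖ, which is
-- closed.
module Submission where

open import Defs
open import Axiom.ExcludedMiddle using (ExcludedMiddle)
open import Data.Empty using (⊥-elim)
open import Data.List.Base using ([]; _∷_; upTo)
open import Data.List.Membership.Propositional.Properties using (∈-upTo⁺)
open import Data.List.Relation.Unary.All as All using (All; []; _∷_)
open import Data.List.Relation.Unary.Any using (Any; here; there)
open import Data.Nat.Base as ℕ using ()
open import Data.Product using (∃; ∃₂; _×_; _,_; proj₁; proj₂)
open import Data.Rational.Base using (0ℚ; 1ℚ; _+_; _-_; -_; _<_; _≤_; _⊓_)
open import Data.Rational.Properties using (+-comm; +-assoc; +-inverseˡ; +-inverseʳ; +-identityʳ; +-monoˡ-<; +-mono-≤; <-irrefl; <-≤-trans; ≤-<-trans; <-dense; ≮⇒≥; _<?_; ⊓-sel; p⊓q≤p; p⊓q≤q)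
open import Data.Sum.Base using (inj₁; inj₂)
open import Data.Unit.Base using (⊤)
open import Function.Base using (_∘_)
open import Function.Bundles using (Equivalence; mk⇔)
open import Level using (Lift; lift)
open import Relation.Binary.Bundles using (Setoid)
open import Relation.Binary.Core using (Rel)
open import Relation.Binary.PropositionalEquality using (_≡_; refl; sym; cong; subst; module ≡-Reasoning)
open import Relation.Binary.Structures using (IsEquivalence)
open import Relation.Nullary using (¬_; yes; no)
open import Relation.Nullary.Decidable using (from-yes)
open import Relation.Unary using (Pred; _∈_; ∁)

open Equivalence using (to; from)

p+[q-p]≡q : ∀ p q → p + (q - p) ≡ q
p+[q-p]≡q p q = begin
  p + (q - p)     ≡⟨ +-comm p (q - p) ⟩
  (q - p) + p     ≡⟨ +-assoc q (- p) p ⟩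
  q + (- p + p)   ≡⟨ cong (q +_) (+-inverseˡ p) ⟩
  q + 0ℚ          ≡⟨ +-identityʳ q ⟩
  q               ∎
  where open ≡-Reasoning

p<q⇒0<q-p : ∀ {p q} → p < q → 0ℚ < q - p
p<q⇒0<q-p {p} {q} p<q = subst (_< q - p) (+-inverseʳ p) (+-monoˡ-< (- p) p<q)

0<p+p⇒0<p : ∀ {p} → 0ℚ < p + p → 0ℚ < p
0<p+p⇒0<p {p} 0<p+p with 0ℚ <? p
... | yes 0<p = 0<p
... | no  0≮p = ⊥-elim (<-irrefl refl (<-≤-trans 0<p+p (+-mono-≤ (≮⇒≥ 0≮p) (≮⇒≥ 0≮p))))

p<q∧p<r⇒p<q⊓r : ∀ {p q r} → p < q → p < r → p < q ⊓ r
p<q∧p<r⇒p<q⊓r {p} {q} {r} p<q p<r with ⊓-sel q r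
... | inj₁ eq = subst (p <_) (sym eq) p<q
... | inj₂ eq = subst (p <_) (sym eq) p<r

Upper-mono : ∀ r {p q} → p ≤ q → ℝ.Upper r p → ℝ.Upper r q
Upper-mono r {p} {q} p≤q r<p =
  let p′ , p′<p , r<p′ = to (ℝ.upper-rounded r p) r<p
  in from (ℝ.upper-rounded r q) (p′ , <-≤-trans p′<p p≤q , r<p′)

-- Locatedness between `q` and `0ℚ`, or between two positive rationals, leaves two cases each time;
-- the hypotheses exclude the wrong one.
nonpositive⇒≃0 : ∀ r → (∀ {q} → r <ᵣ q → 0ℚ < q) →
  ¬ (∃ λ q → 0ℚ < q × ℝ.Lower r q) → r ≃ 0ℝ
nonpositive⇒≃0 r nonneg nonpos q = mk⇔ lower⇒ lower⇐ , mk⇔ nonneg upper⇐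
  where
  open ℝ r

  lower⇒ : Lower q → q < 0ℚ
  lower⇒ q<r with q <? 0ℚ
  ... | yes q<0 = q<0
  ... | no  q≮0 =
    -- `q` may be `0ℚ` itself; roundedness moves up to a strictly positive rational, as `nonpos`
    -- demands.
    let p , q<p , p<r = to (lower-rounded q) q<r
    in ⊥-elim (nonpos (p , ≤-<-trans (≮⇒≥ q≮0) q<p , p<r))

  lower⇐ : q < 0ℚ → Lower q
  lower⇐ q<0 with located q<0
  ... | inj₁ q<r = q<r
  ... | inj₂ r<0 = ⊥-elim (<-irrefl refl (nonneg r<0))

  upper⇐ : 0ℚ < q → Upper q
  upper⇐ 0<q with <-dense 0<q
  ... | p , 0<p , p<q with located p<q
  ...   | inj₁ p<r = ⊥-elim (nonpos (p , 0<p , p<r))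
  ...   | inj₂ r<q = r<q

module _ {ℓ} (X : RecursivePolishSpace ℓ) where
  open RecursivePolishSpace X
  private module S = Setoid setoid

  -- The triangle inequality along `x`, `y`, `x` bounds `d x x`, which is zero, by `q + q`.
  d-nonneg : ∀ x y {q} → d x y <ᵣ q → 0ℚ < q
  d-nonneg x y {q} dxy<q = 0<p+p⇒0<p
    (to (proj₂ (from (d-zero x x) S.refl (q + q)))
      (triangle x y x dxy<q (to (proj₂ (d-sym x y q)) dxy<q)))

  ≈⇒d<ε : ∀ {x y ε} → x ≈ y → 0ℚ < ε → d x y <ᵣ ε
  ≈⇒d<ε {x} {y} {ε} x≈y = from (proj₂ (from (d-zero x y) x≈y ε))

  module _ {i} {I : Set i} {A : I → Pred Carrier ℓ} (A-open : ∀ i → Open X (A i)) where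

    -- Serves twice: with points as indices for the finite subcover in the tube lemma, and with path
    -- lengths as indices for a finite union of closed sets, seen through complements.
    ⋂-ball : ∀ is {x} → All (λ i → x ∈ A i) is →
      ∃ λ ε → 0ℚ < ε × (∀ {y} → d x y <ᵣ ε → All (λ i → y ∈ A i) is)
    ⋂-ball []       _                 = 1ℚ , from-yes (0ℚ <? 1ℚ) , λ _ → []
    ⋂-ball (i ∷ is) {x} (x∈Aᵢ ∷ x∈As) =
      let ε , 0<ε , ball⊆Aᵢ = A-open i x∈Aᵢ
          δ , 0<δ , ball⊆As = ⋂-ball is x∈As
      in ε ⊓ δ , p<q∧p<r⇒p<q⊓r 0<ε 0<δ , λ {y} dxy<ε⊓δ →
           ball⊆Aᵢ (Upper-mono (d x y) (p⊓q≤p ε δ) dxy<ε⊓δ) ∷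
           ball⊆As (Upper-mono (d x y) (p⊓q≤q ε δ) dxy<ε⊓δ)

  module _ (em : ExcludedMiddle ℓ) where

    -- If no positive rational lay below `d y x`, the distance would be zero; excluded middle
    -- therefore yields one, and it is the radius.
    singleton-closed : ∀ x → Closed X (_≈ x)
    singleton-closed x {y} y≉x with em {Lift ℓ (∃ λ q → 0ℚ < q × ℝ.Lower (d y x) q)}
    ... | no  nonpos =
      ⊥-elim (y≉x (to (d-zero y x)
        (nonpositive⇒≃0 (d y x) (d-nonneg y x) (nonpos ∘ lift))))
    ... | yes (lift (q , 0<q , q<dyx)) = q , 0<q , λ {z} dyz<q z≈x →
      -- Rounding down to `p` leaves the slack `q - p`, which exceeds the zero distance from `z` to
      -- `x`.
      let p , p<q , dyz<p = to (ℝ.upper-rounded (d y z) q) dyz<q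
          dyx<q = subst (d y x <ᵣ_) (p+[q-p]≡q p q)
                    (triangle y z x dyz<p (≈⇒d<ε z≈x (p<q⇒0<q-p p<q)))
      in ℝ.disjoint (d y x) q (q<dyx , dyx<q)

    module _ (compact : Compact X) {G : Rel Carrier ℓ} (G-closed : IsClosedGraph X G) where

      -- The sets `V w` cover the space. Over a finite subcover the sets `U w` meet in a
      -- neighbourhood of `y`; a neighbour in `A` of a point there would lie in some chosen `V w`,
      -- against the choice of that box.
      neighbours-closed : ∀ {A} → Closed X A → Closed X (λ y → ∃ λ w → G y w × w ∈ A)
      neighbours-closed {A} A-closed {y} y∉N =
        let ws , cover = compact V V-open (λ w → w , w∈V w)
            ε , 0<ε , ball⊆⋂U = ⋂-ball U-open ws (All.universal y∈U ws)
        in ε , 0<ε , λ dyz<ε (w , Gzw , w∈A) →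
             separated Gzw w∈A (ball⊆⋂U dyz<ε) (cover w)
        where
        -- The last clause says that `U` × `V` misses `G` ∩ (X × `A`). This form also covers `w`
        -- outside `A`, where `G` may hold at `(y , w)`: there `V` is `∁ A` and `U` the whole space.
        box : ∀ w → ∃₂ λ U V → Open X U × Open X V × y ∈ U × w ∈ V ×
          (∀ {u v} → u ∈ U → v ∈ V → G u v → ¬ v ∈ A)
        box w with em {w ∈ A}
        ... | no  w∉A =
          (λ _ → Lift ℓ ⊤) , ∁ A , (λ _ → 1ℚ , from-yes (0ℚ <? 1ℚ) , _) , A-closed ,
          _ , w∉A , λ _ v∉A _ → v∉A
        ... | yes w∈A =
          let U , V , U-open , V-open , y∈U , w∈V , U×V⊆∁G =
                G-closed (λ Gyw → y∉N (w , Gyw , w∈A))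
          in U , V , U-open , V-open , y∈U , w∈V ,
             λ u∈U v∈V Guv _ → U×V⊆∁G (u∈U , v∈V) Guv

        U V : Carrier → Pred Carrier ℓ
        U w = proj₁ (box w)
        V w = proj₁ (proj₂ (box w))

        U-open : ∀ w → Open X (U w)
        U-open w = let _ , _ , o , _ = box w in o

        V-open : ∀ w → Open X (V w)
        V-open w = let _ , _ , _ , o , _ = box w in o

        y∈U : ∀ w → y ∈ U w
        y∈U w = let _ , _ , _ , _ , m , _ = box w in m

        w∈V : ∀ w → w ∈ V w
        w∈V w = let _ , _ , _ , _ , _ , m , _ = box w in m

        separated : ∀ {u v ws} → G u v → v ∈ A →
          All (λ w → u ∈ U w) ws → ¬ Any (λ w → v ∈ V w) ws
        separated {ws = w ∷ _} Guv v∈A (u∈U ∷ _) (here v∈V) =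
          let _ , _ , _ , _ , _ , _ , sep = box w in sep u∈U v∈V Guv v∈A
        separated Guv v∈A (_ ∷ u∈Us) (there v∈Vs) = separated Guv v∈A u∈Us v∈Vs

      -- Induction on `n`. The fixed point `x` is the far end of the path, so `cons` splits off an
      -- edge at the moving end and leaves a shorter path to `x`.
      path-closed : ∀ x n → Closed X (λ y → Path X G n y x)
      path-closed x ℕ.zero y∉P =
        let ε , 0<ε , ball⊆ = singleton-closed x (y∉P ∘ nil)
        in ε , 0<ε , λ { dyz<ε (nil z≈x) → ball⊆ dyz<ε z≈x }
      path-closed x (ℕ.suc n) y∉P =
        let ε , 0<ε , ball⊆ = neighbours-closed (path-closed x n)
                                (λ { (_ , Gyw , p) → y∉P (cons Gyw p) })
        in ε , 0<ε , λ { dyz<ε (cons Gzw p) → ball⊆ dyz<ε (_ , Gzw , p) }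

      class-closed : ∀ {E k} → IsEquivalence E → IsGraphing X E G →
        DiameterAtMost X G k → ∀ x → Closed X (EquivalenceClass X E x)
      class-closed {k = k} E-equiv graphing diam≤k x {y} ¬Exy =
        -- `upTo (ℕ.suc k)` lists 0, ..., `k`, all lengths that the diameter bound can return.
        -- Symmetry of `E` is applied because the class puts `x` first while the paths end at `x`.
        let ε , 0<ε , ball⊆ = ⋂-ball (path-closed x) (upTo (ℕ.suc k))
              (All.universal (λ n p → ¬Exy (E.sym (to (connectedness y x) (n , p)))) _)
        in ε , 0<ε , λ {z} dyz<ε Exz →
             let n , n≤k , p = diam≤k z x (from (connectedness z x) (E.sym Exz))
             in All.lookup (ball⊆ dyz<ε) (∈-upTo⁺ (ℕ.s≤s n≤k)) p
        where
        module E = IsEquivalence E-equiv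
        open IsGraphing graphing

theorem3p5 : ∀ {ℓ} → ExcludedMiddle ℓ →
    (X : RecursivePolishSpace ℓ) → Compact X →
    (E : Rel (RecursivePolishSpace.Carrier X) ℓ) → IsEquivalenceRelation X E →
    (∃ λ x → ¬ Closed X (EquivalenceClass X E x)) →
    ¬ (∃ λ G → IsGraphing X E G × IsClosedGraph X G × HasFiniteDiameter X G)
theorem3p5 em X compact E E-equiv (x , ¬closed) (G , graphing , G-closed , k , diam≤k , _) =
  ¬closed (class-closed X em compact G-closed
    (IsEquivalenceRelation.isEquivalence E-equiv) graphing diam≤k x)
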